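{- Let $\alpha,\beta$ be fixed nonzero real numbers. There exist constants $C,N>0$, independent of $n$ and of the point set, such that for every $n>N$ and every set $P\subset\mathbb R^2$ of $n$ points, $$|\Pi_{\alpha,\beta}(P)|\le C n^2 .$$
   Context: For a finite set $P\subset\mathbb R^2$ and real numbers $\alpha,\beta$, define the set of ordered triples $$\Pi_{\alpha,\beta}(P)=\{(p,q,r)\in P\times P\times P:\ p\cdot q=\alpha \text{ and } p\cdot r=\beta\},$$ where $\cdot$ is the standard dot product on $\mathbb R^2$ (the points $p,q,r$ need not be distinct). -}

module Defs where

open import Algebra.Bundles using (CommutativeMonoid)
import Algebra.Properties.AbelianGroup
import Algebra.Properties.CommutativeSemigroup
import Algebra.Properties.Ring
open import Data.Integer using (+_)
open import Data.List using (List; length)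
open import Data.List.Relation.Unary.All using (All)
import Data.List.Membership.Setoid as Membership
import Data.List.Relation.Unary.Unique.Setoid as Unique
open import Data.Nat as ℕ using (ℕ)
import Data.Nat.Properties as ℕ
open import Data.Product using (_×_; _,_; ∃; proj₁; proj₂)
open import Data.Product.Relation.Binary.Pointwise.NonDependent using (×-setoid)
open import Data.Rational as ℚ using (ℚ; 0ℚ; 1ℚ; ½; ∣_∣)
import Data.Rational.Properties as ℚ
open import Level using (0ℓ)
open import Relation.Binary.Bundles using (Setoid)
open import Relation.Binary.PropositionalEquality using (_≡_; refl; sym; trans; cong; cong₂; subst)
open import Relation.Nullary using (¬_)
open import Relation.Unary using (Pred)

-- The real numbers are Cauchy sequences of rationals, and equality of reals is
-- the relation _≈_ (the difference tends to 0), so that ℝ is used as a setoid.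

Eventually : Pred ℕ 0ℓ → Set
Eventually A = ∃ λ N → ∀ n → N ℕ.≤ n → A n

IsCauchy : (ℕ → ℚ) → Set
IsCauchy x = ∀ ε → 0ℚ ℚ.< ε →
  ∃ λ N → ∀ m n → N ℕ.≤ m → N ℕ.≤ n → ∣ x m ℚ.- x n ∣ ℚ.< ε

record ℝ : Set where
  constructor mkℝ
  field
    seq    : ℕ → ℚ
    cauchy : IsCauchy seq

open ℝ public

infix 4 _≈_ _<_ _≤_

record _≈_ (x y : ℝ) : Set where
  constructor mk≈
  field
    difference→0 : ∀ ε → 0ℚ ℚ.< ε → Eventually λ n → ∣ seq x n ℚ.- seq y n ∣ ℚ.< ε

_<_ : ℝ → ℝ → Set
x < y = ∃ λ ε → 0ℚ ℚ.< ε × Eventually λ n → seq x n ℚ.+ ε ℚ.≤ seq y n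

_≤_ : ℝ → ℝ → Set
x ≤ y = ¬ (y < x)

open ℚ.≤-Reasoning
open Algebra.Properties.AbelianGroup ℚ.+-0-abelianGroup using (⁻¹-anti-homo‿-; //-rightDividesˡ)
open Algebra.Properties.CommutativeSemigroup
  (CommutativeMonoid.commutativeSemigroup ℚ.+-0-commutativeMonoid) using (interchange)
open Algebra.Properties.Ring ℚ.+-*-ring using (x[y-z]≈xy-xz)

∣p-p∣≡0 : ∀ p → ∣ p ℚ.- p ∣ ≡ 0ℚ
∣p-p∣≡0 p = cong ∣_∣ (ℚ.+-inverseʳ p)

∣p-q∣≡∣q-p∣ : ∀ p q → ∣ p ℚ.- q ∣ ≡ ∣ q ℚ.- p ∣
∣p-q∣≡∣q-p∣ p q = trans (sym (ℚ.∣-p∣≡∣p∣ (p ℚ.- q))) (cong ∣_∣ (⁻¹-anti-homo‿- p q))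

telescope : ∀ p q r → (p ℚ.- q) ℚ.+ (q ℚ.- r) ≡ p ℚ.- r
telescope p q r = trans (sym (ℚ.+-assoc (p ℚ.- q) q (ℚ.- r)))
                        (cong (ℚ._- r) (//-rightDividesˡ q p))

+-difference : ∀ p q r s → (p ℚ.- q) ℚ.+ (r ℚ.- s) ≡ (p ℚ.+ r) ℚ.- (q ℚ.+ s)
+-difference p q r s = trans (interchange p (ℚ.- q) r (ℚ.- s))
                             (cong ((p ℚ.+ r) ℚ.+_) (sym (ℚ.neg-distrib-+ q s)))

*-difference : ∀ p q r s → p ℚ.* (r ℚ.- s) ℚ.+ s ℚ.* (p ℚ.- q) ≡ p ℚ.* r ℚ.- q ℚ.* s
*-difference p q r s = trans
  (cong₂ ℚ._+_ (x[y-z]≈xy-xz p r s)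
    (trans (x[y-z]≈xy-xz s p q) (cong₂ ℚ._-_ (ℚ.*-comm s p) (ℚ.*-comm s q))))
  (telescope (p ℚ.* r) (p ℚ.* s) (q ℚ.* s))

half+half : ∀ p → ½ ℚ.* p ℚ.+ ½ ℚ.* p ≡ p
half+half p = trans (sym (ℚ.*-distribʳ-+ p ½ ½)) (ℚ.*-identityˡ p)

half-pos : ∀ {p} → 0ℚ ℚ.< p → 0ℚ ℚ.< ½ ℚ.* p
half-pos {p} 0<p = subst (ℚ._< ½ ℚ.* p) (ℚ.*-zeroʳ ½) (ℚ.*-monoʳ-<-pos ½ 0<p)

∣+∣-<-halves : ∀ {ε} p q → ∣ p ∣ ℚ.< ½ ℚ.* ε → ∣ q ∣ ℚ.< ½ ℚ.* ε → ∣ p ℚ.+ q ∣ ℚ.< ε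
∣+∣-<-halves {ε} p q p< q< = begin-strict
  ∣ p ℚ.+ q ∣           ≤⟨ ℚ.∣p+q∣≤∣p∣+∣q∣ p q ⟩
  ∣ p ∣ ℚ.+ ∣ q ∣       <⟨ ℚ.+-mono-< p< q< ⟩
  ½ ℚ.* ε ℚ.+ ½ ℚ.* ε   ≡⟨ half+half ε ⟩
  ε                     ∎

opaque
  +-cauchy : ∀ {x y} → IsCauchy x → IsCauchy y → IsCauchy (λ n → x n ℚ.+ y n)
  +-cauchy {x} {y} cx cy ε 0<ε with cx (½ ℚ.* ε) (half-pos 0<ε) | cy (½ ℚ.* ε) (half-pos 0<ε)
  ... | M , hx | N , hy = M ℕ.⊔ N , λ m n p q →
    subst (λ z → ∣ z ∣ ℚ.< ε)
      (+-difference (x m) (x n) (y m) (y n))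
      (∣+∣-<-halves (x m ℚ.- x n) (y m ℚ.- y n)
        (hx m n (ℕ.m⊔n≤o⇒m≤o M N p) (ℕ.m⊔n≤o⇒m≤o M N q))
        (hy m n (ℕ.m⊔n≤o⇒n≤o M N p) (ℕ.m⊔n≤o⇒n≤o M N q)))

opaque
  cauchy-bounded : ∀ {x} → IsCauchy x →
    ∃ λ B → 0ℚ ℚ.< B × Eventually λ n → ∣ x n ∣ ℚ.< B
  cauchy-bounded {x} cx with cx 1ℚ (ℚ.positive⁻¹ 1ℚ)
  ... | N , h = 1ℚ ℚ.+ ∣ x N ∣ , ℚ.+-mono-<-≤ (ℚ.positive⁻¹ 1ℚ) (ℚ.0≤∣p∣ (x N)) ,
    N , λ n N≤n → begin-strict
      ∣ x n ∣                        ≡⟨ cong ∣_∣ (sym (//-rightDividesˡ (x N) (x n))) ⟩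
      ∣ (x n ℚ.- x N) ℚ.+ x N ∣      ≤⟨ ℚ.∣p+q∣≤∣p∣+∣q∣ (x n ℚ.- x N) (x N) ⟩
      ∣ x n ℚ.- x N ∣ ℚ.+ ∣ x N ∣    <⟨ ℚ.+-monoˡ-< ∣ x N ∣ (h n N N≤n ℕ.≤-refl) ⟩
      1ℚ ℚ.+ ∣ x N ∣                 ∎

opaque
  shrink : ∀ {B ε} → 0ℚ ℚ.< B → 0ℚ ℚ.< ε →
    ∃ λ δ → 0ℚ ℚ.< δ × (∀ p q → ∣ p ∣ ℚ.< B → ∣ q ∣ ℚ.< δ → ∣ p ℚ.* q ∣ ℚ.< ε)
  shrink {B} {ε} 0<B 0<ε = δ , 0<δ , bound
    where
      instance
        B-pos : ℚ.Positive B
        B-pos = ℚ.positive 0<B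
        B-nonZero : ℚ.NonZero B
        B-nonZero = ℚ.pos⇒nonZero B
        1/B-pos : ℚ.Positive (ℚ.1/ B)
        1/B-pos = ℚ.1/pos⇒pos B
      δ : ℚ
      δ = (ℚ.1/ B) ℚ.* ε
      0<δ : 0ℚ ℚ.< δ
      0<δ = subst (ℚ._< δ) (ℚ.*-zeroʳ (ℚ.1/ B)) (ℚ.*-monoʳ-<-pos (ℚ.1/ B) 0<ε)
      bound : ∀ p q → ∣ p ∣ ℚ.< B → ∣ q ∣ ℚ.< δ → ∣ p ℚ.* q ∣ ℚ.< ε
      bound p q p< q< = begin-strict
        ∣ p ℚ.* q ∣          ≡⟨ ℚ.∣p*q∣≡∣p∣*∣q∣ p q ⟩
        ∣ p ∣ ℚ.* ∣ q ∣      ≤⟨ ℚ.*-monoʳ-≤-nonNeg ∣ q ∣ {{ℚ.∣-∣-nonNeg q}} (ℚ.<⇒≤ p<) ⟩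
        B ℚ.* ∣ q ∣          <⟨ ℚ.*-monoʳ-<-pos B q< ⟩
        B ℚ.* δ              ≡⟨ sym (ℚ.*-assoc B (ℚ.1/ B) ε) ⟩
        B ℚ.* ℚ.1/ B ℚ.* ε   ≡⟨ cong (ℚ._* ε) (ℚ.*-inverseʳ B) ⟩
        1ℚ ℚ.* ε             ≡⟨ ℚ.*-identityˡ ε ⟩
        ε                    ∎

opaque
  *-cauchy : ∀ {x y} → IsCauchy x → IsCauchy y → IsCauchy (λ n → x n ℚ.* y n)
  *-cauchy {x} {y} cx cy ε 0<ε
    with cauchy-bounded cx | cauchy-bounded cy
  ... | A , 0<A , K , hA | B , 0<B , L , hB
    with shrink 0<A (half-pos 0<ε) | shrink 0<B (half-pos 0<ε)
  ... | δ , 0<δ , sA | η , 0<η , sB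
    with cy δ 0<δ | cx η 0<η
  ... | M , hy | N , hx = (K ℕ.⊔ L) ℕ.⊔ (M ℕ.⊔ N) , λ m n p q →
    let p₁ = ℕ.m⊔n≤o⇒m≤o (K ℕ.⊔ L) (M ℕ.⊔ N) p
        p₂ = ℕ.m⊔n≤o⇒n≤o (K ℕ.⊔ L) (M ℕ.⊔ N) p
        q₁ = ℕ.m⊔n≤o⇒m≤o (K ℕ.⊔ L) (M ℕ.⊔ N) q
        q₂ = ℕ.m⊔n≤o⇒n≤o (K ℕ.⊔ L) (M ℕ.⊔ N) q
    in subst (λ z → ∣ z ∣ ℚ.< ε)
      (*-difference (x m) (x n) (y m) (y n))
      (∣+∣-<-halves (x m ℚ.* (y m ℚ.- y n)) (y n ℚ.* (x m ℚ.- x n))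
        (sA (x m) (y m ℚ.- y n) (hA m (ℕ.m⊔n≤o⇒m≤o K L p₁))
          (hy m n (ℕ.m⊔n≤o⇒m≤o M N p₂) (ℕ.m⊔n≤o⇒m≤o M N q₂)))
        (sB (y n) (x m ℚ.- x n) (hB n (ℕ.m⊔n≤o⇒n≤o K L q₁))
          (hx m n (ℕ.m⊔n≤o⇒n≤o M N p₂) (ℕ.m⊔n≤o⇒n≤o M N q₂))))

≈-refl : ∀ {x} → x ≈ x
≈-refl {x} = mk≈ λ ε 0<ε → 0 , λ n _ → subst (ℚ._< ε) (sym (∣p-p∣≡0 (seq x n))) 0<ε

≈-sym : ∀ {x y} → x ≈ y → y ≈ x
≈-sym {x} {y} (mk≈ h) = mk≈ λ ε 0<ε → proj₁ (h ε 0<ε) , λ n N≤n →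
  subst (ℚ._< ε) (∣p-q∣≡∣q-p∣ (seq x n) (seq y n)) (proj₂ (h ε 0<ε) n N≤n)

≈-trans : ∀ {x y z} → x ≈ y → y ≈ z → x ≈ z
≈-trans {x} {y} {z} (mk≈ h) (mk≈ k) = mk≈ λ ε 0<ε →
  let M , hM = h (½ ℚ.* ε) (half-pos 0<ε)
      N , kN = k (½ ℚ.* ε) (half-pos 0<ε)
  in M ℕ.⊔ N , λ n p →
    subst (λ w → ∣ w ∣ ℚ.< ε) (telescope (seq x n) (seq y n) (seq z n))
      (∣+∣-<-halves (seq x n ℚ.- seq y n) (seq y n ℚ.- seq z n)
        (hM n (ℕ.m⊔n≤o⇒m≤o M N p)) (kN n (ℕ.m⊔n≤o⇒n≤o M N p)))

ℝ-setoid : Setoid 0ℓ 0ℓ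
ℝ-setoid = record
  { Carrier       = ℝ
  ; _≈_           = _≈_
  ; isEquivalence = record { refl = ≈-refl ; sym = ≈-sym ; trans = ≈-trans }
  }

infixl 6 _+_
infixl 7 _*_

_+_ : ℝ → ℝ → ℝ
x + y = mkℝ (λ n → seq x n ℚ.+ seq y n) (+-cauchy {seq x} {seq y} (cauchy x) (cauchy y))

_*_ : ℝ → ℝ → ℝ
x * y = mkℝ (λ n → seq x n ℚ.* seq y n) (*-cauchy {seq x} {seq y} (cauchy x) (cauchy y))

fromℚ : ℚ → ℝ
fromℚ p = mkℝ (λ _ → p) λ ε 0<ε → 0 , λ _ _ _ _ → subst (ℚ._< ε) (sym (∣p-p∣≡0 p)) 0<ε

fromℕ : ℕ → ℝ
fromℕ n = fromℚ (+ n ℚ./ 1)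

0ℝ : ℝ
0ℝ = fromℕ 0

ℝ²-setoid : Setoid 0ℓ 0ℓ
ℝ²-setoid = ×-setoid ℝ-setoid ℝ-setoid

ℝ² : Set
ℝ² = Setoid.Carrier ℝ²-setoid

infix 8 _·_

_·_ : ℝ² → ℝ² → ℝ
(p₁ , p₂) · (q₁ , q₂) = p₁ * q₁ + p₂ * q₂

Triple-setoid : Setoid 0ℓ 0ℓ
Triple-setoid = ×-setoid ℝ²-setoid (×-setoid ℝ²-setoid ℝ²-setoid)

Triple : Set
Triple = Setoid.Carrier Triple-setoid

-- A set of n points: a list without repetitions (up to ≈) of length n.
record IsSetOfSize (n : ℕ) (P : List ℝ²) : Set where
  field
    distinct : Unique.Unique ℝ²-setoid P
    size     : length P ≡ n

open Membership ℝ²-setoid public using () renaming (_∈_ to _∈ₚ_)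

Π : ℝ → ℝ → List ℝ² → Pred Triple 0ℓ
Π α β P (p , q , r) = (p ∈ₚ P × q ∈ₚ P × r ∈ₚ P) × (p · q ≈ α × p · r ≈ β)

-- Since ≈ on ℝ is undecidable, the elements of Π α β P cannot in general be
-- counted constructively.  The bound ∣ A ∣≤ b says instead that every list of
-- pairwise distinct elements of A has length at most b.
∣_∣≤_ : Pred Triple 0ℓ → ℝ → Set
∣ A ∣≤ b = (ts : List Triple) → Unique.Unique Triple-setoid ts → All A ts →
  fromℕ (length ts) ≤ b

{-# OPTIONS --safe #-}

-- For a triple (p , q , r), Cramer's rule gives
--   det q r * p₁ ≈ (p · q) * r₂ - (p · r) * q₂,
--   det q r * p₂ ≈ (p · r) * q₁ - (p · q) * r₁.
-- If det q r ≉ 0, then p is determined by (q , r); if det q r ≈ 0, then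
-- α r ≈ β q, so r is determined by q since α ≉ 0.  Each kind of triple is thus
-- determined by a pair of points of P, and there are at most 2 n² triples.  The
-- bound is a negative statement, so det q r ≈ 0 may be decided for each of the
-- finitely many triples of a given list.
module Submission where

open import Defs
open import Data.Fin as Fin using (Fin; zero; suc; combine)
import Data.Fin.Properties as Fin
open import Data.Integer as ℤ using (+_)
import Data.Integer.Properties as ℤ
open import Data.List using (List; length; lookup; _∷_)
open import Data.List.Membership.Propositional.Properties using (∈-lookup)
import Data.List.Membership.Setoid.Properties as Membership
open import Data.List.Relation.Unary.All as All using (All)
open import Data.List.Relation.Unary.AllPairs using (AllPairs; _∷_)
open import Data.List.Relation.Unary.Any using (index)
import Data.List.Relation.Unary.Unique.Setoid as Unique
open import Data.Nat as ℕ using (ℕ; _^_; s≤s)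
import Data.Nat.Properties as ℕ
open import Data.Product using (∃; _×_; _,_; proj₁; proj₂)
open import Data.Rational as ℚ using (ℚ; 0ℚ; 1ℚ; ½; ∣_∣)
import Data.Rational.Properties as ℚ
open import Data.Rational.Solver using (module +-*-Solver)
open import Data.Rational.Unnormalised as ℚᵘ using (mkℚᵘ)
import Data.Rational.Unnormalised.Properties as ℚᵘ
open import Data.Sum using (_⊎_; inj₁; inj₂)
open import Function using (_∘_)
open import Level using (0ℓ)
open import Relation.Binary.Bundles using (Setoid)
open import Relation.Binary.Core using (Rel)
open import Relation.Binary.PropositionalEquality using (_≡_; refl; sym; trans; cong; subst)
import Relation.Binary.Reasoning.Setoid as SetoidReasoning
open import Relation.Nullary using (¬_; Dec; yes; no; contradiction)
open import Relation.Nullary.Decidable using (¬¬-excluded-middle)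
open import Relation.Nullary.Negation using (¬¬-Monad)

open +-*-Solver using (solve; con; _:+_; _:*_; _:-_; _:=_)
private module ≤-ℚ = ℚ.≤-Reasoning
private module ≈-ℝ = SetoidReasoning ℝ-setoid

-- Congruence and subtraction for real arithmetic

pointwise : ∀ {x y} → (∀ n → seq x n ≡ seq y n) → x ≈ y
pointwise {x} {y} h = mk≈ λ ε 0<ε → 0 , λ n _ →
  subst (ℚ._< ε) (sym (trans (cong (λ z → ∣ z ℚ.- seq y n ∣) (h n)) (∣p-p∣≡0 (seq y n)))) 0<ε

+-cong : ∀ {x y u v} → x ≈ y → u ≈ v → x + u ≈ y + v
+-cong {x} {y} {u} {v} (mk≈ h) (mk≈ k) = mk≈ λ ε 0<ε →
  let M , hM = h (½ ℚ.* ε) (half-pos 0<ε)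
      N , kN = k (½ ℚ.* ε) (half-pos 0<ε)
  in M ℕ.⊔ N , λ n p →
    subst (λ w → ∣ w ∣ ℚ.< ε) (+-difference (seq x n) (seq y n) (seq u n) (seq v n))
      (∣+∣-<-halves (seq x n ℚ.- seq y n) (seq u n ℚ.- seq v n)
        (hM n (ℕ.m⊔n≤o⇒m≤o M N p)) (kN n (ℕ.m⊔n≤o⇒n≤o M N p)))

-- The fixed factor is eventually bounded, so `shrink` turns a small difference of the other factors
-- into a small difference of products.
*-congˡ : ∀ {x u v} → u ≈ v → x * u ≈ x * v
*-congˡ {x} {u} {v} (mk≈ h) = mk≈ λ ε 0<ε →
  let B , 0<B , M , hB = cauchy-bounded {seq x} (cauchy x)
      δ , 0<δ , s      = shrink 0<B 0<ε
      N , hN           = h δ 0<δ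
  in M ℕ.⊔ N , λ n p →
    subst (λ w → ∣ w ∣ ℚ.< ε)
      (solve 3 (λ a b c → a :* (b :- c) := a :* b :- a :* c) refl (seq x n) (seq u n) (seq v n))
      (s (seq x n) (seq u n ℚ.- seq v n)
        (hB n (ℕ.m⊔n≤o⇒m≤o M N p)) (hN n (ℕ.m⊔n≤o⇒n≤o M N p)))

*-comm : ∀ {x y} → x * y ≈ y * x
*-comm {x} {y} = pointwise λ n → ℚ.*-comm (seq x n) (seq y n)

*-cong : ∀ {x y u v} → x ≈ y → u ≈ v → x * u ≈ y * v
*-cong {x} {y} {u} {v} x≈y u≈v = begin
  x * u  ≈⟨ *-congˡ u≈v ⟩
  x * v  ≈⟨ *-comm ⟩
  v * x  ≈⟨ *-congˡ x≈y ⟩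
  v * y  ≈⟨ *-comm ⟩
  y * v  ∎
  where open ≈-ℝ

infixl 6 _-_

-- Multiplying by the constant -1 replaces negation: the Cauchy property and the congruence are then
-- inherited from `_+_` and `_*_`.
_-_ : ℝ → ℝ → ℝ
x - y = x + fromℚ (ℚ.- 1ℚ) * y

-‿cong : ∀ {x y u v} → x ≈ y → u ≈ v → x - u ≈ y - v
-‿cong x≈y u≈v = +-cong x≈y (*-congˡ u≈v)

x-y≈0⇒x≈y : ∀ {x y} → x - y ≈ 0ℝ → x ≈ y
x-y≈0⇒x≈y {x} {y} x-y≈0 = begin
  x              ≈⟨ pointwise (λ n → solve 2 (λ a b → a := a :+ con (ℚ.- 1ℚ) :* b :+ b) refl (seq x n) (seq y n)) ⟩
  (x - y) + y    ≈⟨ +-cong x-y≈0 ≈-refl ⟩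
  0ℝ + y         ≈⟨ pointwise (λ n → ℚ.+-identityˡ (seq y n)) ⟩
  y              ∎
  where open ≈-ℝ

x≈y⇒x-y≈0 : ∀ {x y} → x ≈ y → x - y ≈ 0ℝ
x≈y⇒x-y≈0 {x} {y} x≈y = ≈-trans (-‿cong x≈y ≈-refl)
  (pointwise λ n → solve 1 (λ b → b :+ con (ℚ.- 1ℚ) :* b := con 0ℚ) refl (seq y n))

-- Null sequences and cancellation of nonzero factors

IsNull : (ℕ → ℚ) → Set
IsNull x = ∀ ε → 0ℚ ℚ.< ε → Eventually λ n → ∣ x n ∣ ℚ.< ε

null⇒≈0 : ∀ {x} → IsNull (seq x) → x ≈ 0ℝ
null⇒≈0 {x} h = mk≈ λ ε 0<ε → let N , hN = h ε 0<ε in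
  N , λ n N≤n → subst (λ z → ∣ z ∣ ℚ.< ε) (sym (ℚ.+-identityʳ (seq x n))) (hN n N≤n)

≈0⇒null : ∀ {x} → x ≈ 0ℝ → IsNull (seq x)
≈0⇒null {x} (mk≈ h) ε 0<ε = let N , hN = h ε 0<ε in
  N , λ n N≤n → subst (λ z → ∣ z ∣ ℚ.< ε) (ℚ.+-identityʳ (seq x n)) (hN n N≤n)

-- A single rational comparison decides: the tail stays within ε/4 of `x N`, so comparing that term
-- with ε/2 either keeps the tail below ε or keeps it at least ε/4 away from 0.
small-or-apart : ∀ {x} → IsCauchy x → ∀ {ε} → 0ℚ ℚ.< ε →
  (Eventually λ n → ∣ x n ∣ ℚ.< ε) ⊎
  (∃ λ δ → 0ℚ ℚ.< δ × Eventually λ n → δ ℚ.≤ ∣ x n ∣)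
small-or-apart {x} cx {ε} 0<ε with cx (½ ℚ.* (½ ℚ.* ε)) (half-pos (half-pos 0<ε))
... | N , h with ∣ x N ∣ ℚ.<? ½ ℚ.* ε
... | yes xN< = inj₁ (N , λ n N≤n → subst (λ z → ∣ z ∣ ℚ.< ε)
        (solve 2 (λ a b → a :- b :+ b := a) refl (x n) (x N))
        (∣+∣-<-halves (x n ℚ.- x N) (x N)
          (ℚ.<-trans (h n N N≤n ℕ.≤-refl) quarter<half) xN<))
  where
    open ≤-ℚ
    quarter<half : ½ ℚ.* (½ ℚ.* ε) ℚ.< ½ ℚ.* ε
    quarter<half = begin-strict
      ½ ℚ.* (½ ℚ.* ε)                       ≡⟨ ℚ.+-identityʳ (½ ℚ.* (½ ℚ.* ε)) ⟨
      ½ ℚ.* (½ ℚ.* ε) ℚ.+ 0ℚ                <⟨ ℚ.+-monoʳ-< (½ ℚ.* (½ ℚ.* ε)) (half-pos (half-pos 0<ε)) ⟩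
      ½ ℚ.* (½ ℚ.* ε) ℚ.+ ½ ℚ.* (½ ℚ.* ε)   ≡⟨ half+half (½ ℚ.* ε) ⟩
      ½ ℚ.* ε                               ∎
... | no xN≮ = inj₂ (½ ℚ.* (½ ℚ.* ε) , half-pos (half-pos 0<ε) , N , λ n N≤n →
        ℚ.≮⇒≥ λ xn< → xN≮ (subst (λ z → ∣ z ∣ ℚ.< ½ ℚ.* ε)
          (solve 2 (λ a b → a :- b :+ b := a) refl (x N) (x n))
          (∣+∣-<-halves (x N ℚ.- x n) (x n) (h N n ℕ.≤-refl N≤n) xn<)))

-- For each ε, either `y` is eventually below ε, as wanted, or it is bounded away from 0. The latter
-- would make `x` null, since the product is null. Neither `y ≈ 0ℝ` nor a positive lower bound for
-- `x` has to be decided.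
x≉0∧x*y≈0⇒y≈0 : ∀ {x y} → ¬ (x ≈ 0ℝ) → x * y ≈ 0ℝ → y ≈ 0ℝ
x≉0∧x*y≈0⇒y≈0 {x} {y} x≉0 xy≈0 = null⇒≈0 null
  where
    open ≤-ℚ
    x-null : (∃ λ δ → 0ℚ ℚ.< δ × Eventually λ n → δ ℚ.≤ ∣ seq y n ∣) → IsNull (seq x)
    x-null (δ , 0<δ , M , hM) ε 0<ε = M ℕ.⊔ N , λ n p →
      ℚ.*-cancelˡ-<-nonNeg δ {{ℚ.pos⇒nonNeg δ}} (begin-strict
        δ ℚ.* ∣ seq x n ∣            ≤⟨ ℚ.*-monoʳ-≤-nonNeg ∣ seq x n ∣ {{ℚ.∣-∣-nonNeg (seq x n)}}
                                          (hM n (ℕ.m⊔n≤o⇒m≤o M N p)) ⟩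
        ∣ seq y n ∣ ℚ.* ∣ seq x n ∣  ≡⟨ ℚ.*-comm ∣ seq y n ∣ ∣ seq x n ∣ ⟩
        ∣ seq x n ∣ ℚ.* ∣ seq y n ∣  ≡⟨ ℚ.∣p*q∣≡∣p∣*∣q∣ (seq x n) (seq y n) ⟨
        ∣ seq x n ℚ.* seq y n ∣      <⟨ proj₂ xy-small n (ℕ.m⊔n≤o⇒n≤o M N p) ⟩
        δ ℚ.* ε                      ∎)
      where
        instance
          δ-pos : ℚ.Positive δ
          δ-pos = ℚ.positive 0<δ
        0<δε : 0ℚ ℚ.< δ ℚ.* ε
        0<δε = subst (ℚ._< δ ℚ.* ε) (ℚ.*-zeroʳ δ) (ℚ.*-monoʳ-<-pos δ 0<ε)
        xy-small : Eventually λ n → ∣ seq x n ℚ.* seq y n ∣ ℚ.< δ ℚ.* ε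
        -- The tolerance is scaled by δ so that cancelling the lower bound δ of the other factor
        -- leaves ε.
        xy-small = ≈0⇒null xy≈0 (δ ℚ.* ε) 0<δε
        N : ℕ
        N = proj₁ xy-small
    null : IsNull (seq y)
    null ε 0<ε with small-or-apart {seq y} (cauchy y) 0<ε
    ... | inj₁ small = small
    ... | inj₂ apart = contradiction (null⇒≈0 (x-null apart)) x≉0

*-cancelˡ : ∀ {x y z} → ¬ (x ≈ 0ℝ) → x * y ≈ x * z → y ≈ z
*-cancelˡ {x} {y} {z} x≉0 xy≈xz = x-y≈0⇒x≈y (x≉0∧x*y≈0⇒y≈0 x≉0 (≈-trans
  (pointwise λ n → solve 3
    (λ a b c → a :* (b :+ con (ℚ.- 1ℚ) :* c) := a :* b :+ con (ℚ.- 1ℚ) :* (a :* c))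
    refl (seq x n) (seq y n) (seq z n))
  (x≈y⇒x-y≈0 xy≈xz)))

x≈0⇒x*y≈0 : ∀ {x y} → x ≈ 0ℝ → x * y ≈ 0ℝ
x≈0⇒x*y≈0 {x} {y} x≈0 = ≈-trans (*-cong x≈0 ≈-refl) (pointwise λ n → ℚ.*-zeroˡ (seq y n))

-- Determinants and Cramer's rule

_≈²_ : Rel ℝ² 0ℓ
_≈²_ = Setoid._≈_ ℝ²-setoid

det : ℝ² → ℝ² → ℝ
det (q₁ , q₂) (r₁ , r₂) = q₁ * r₂ - q₂ * r₁

det-cong : ∀ {q q′ r r′} → q ≈² q′ → r ≈² r′ → det q r ≈ det q′ r′
det-cong (q₁≈ , q₂≈) (r₁≈ , r₂≈) = -‿cong (*-cong q₁≈ r₂≈) (*-cong q₂≈ r₁≈)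

module _ {α β : ℝ} where

  -- With the dot products written out in place of `α` and `β` this is a polynomial identity, valid
  -- term by term; the constants are substituted afterwards.
  cramer₁ : ∀ p₁ p₂ q₁ q₂ r₁ r₂ → let p = p₁ , p₂; q = q₁ , q₂; r = r₁ , r₂ in
    p · q ≈ α → p · r ≈ β → det q r * p₁ ≈ α * r₂ - β * q₂
  cramer₁ p₁ p₂ q₁ q₂ r₁ r₂ pq≈α pr≈β = ≈-trans
    (pointwise λ n → solve 6
      (λ p₁ p₂ q₁ q₂ r₁ r₂ →
        (q₁ :* r₂ :+ con (ℚ.- 1ℚ) :* (q₂ :* r₁)) :* p₁ :=
        (p₁ :* q₁ :+ p₂ :* q₂) :* r₂ :+ con (ℚ.- 1ℚ) :* ((p₁ :* r₁ :+ p₂ :* r₂) :* q₂))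
      refl (seq p₁ n) (seq p₂ n) (seq q₁ n) (seq q₂ n) (seq r₁ n) (seq r₂ n))
    (-‿cong (*-cong pq≈α ≈-refl) (*-cong pr≈β ≈-refl))

  cramer₂ : ∀ p₁ p₂ q₁ q₂ r₁ r₂ → let p = p₁ , p₂; q = q₁ , q₂; r = r₁ , r₂ in
    p · q ≈ α → p · r ≈ β → det q r * p₂ ≈ β * q₁ - α * r₁
  cramer₂ p₁ p₂ q₁ q₂ r₁ r₂ pq≈α pr≈β = ≈-trans
    (pointwise λ n → solve 6
      (λ p₁ p₂ q₁ q₂ r₁ r₂ →
        (q₁ :* r₂ :+ con (ℚ.- 1ℚ) :* (q₂ :* r₁)) :* p₂ :=
        (p₁ :* r₁ :+ p₂ :* r₂) :* q₁ :+ con (ℚ.- 1ℚ) :* ((p₁ :* q₁ :+ p₂ :* q₂) :* r₁))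
      refl (seq p₁ n) (seq p₂ n) (seq q₁ n) (seq q₂ n) (seq r₁ n) (seq r₂ n))
    (-‿cong (*-cong pr≈β ≈-refl) (*-cong pq≈α ≈-refl))

  -- The right-hand sides in Cramer's rule involve only `q` and `r`, so they agree for both triples.
  -- `det-cong` identifies the determinants, and the nonzero common factor cancels.
  independent⇒p-unique : ∀ {p q r p′ q′ r′} → ¬ (det q r ≈ 0ℝ) →
    p · q ≈ α → p · r ≈ β → p′ · q′ ≈ α → p′ · r′ ≈ β →
    q ≈² q′ → r ≈² r′ → p ≈² p′
  independent⇒p-unique {p₁ , p₂} {q@(q₁ , q₂)} {r@(r₁ , r₂)} {p₁′ , p₂′} {q′@(q₁′ , q₂′)} {r′@(r₁′ , r₂′)}
    d≉0 pq pr pq′ pr′ q≈@(q₁≈ , q₂≈) r≈@(r₁≈ , r₂≈) =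
      cancel (cramer₁ p₁ p₂ q₁ q₂ r₁ r₂ pq pr) (cramer₁ p₁′ p₂′ q₁′ q₂′ r₁′ r₂′ pq′ pr′)
        (-‿cong (*-congˡ r₂≈) (*-congˡ q₂≈)) ,
      cancel (cramer₂ p₁ p₂ q₁ q₂ r₁ r₂ pq pr) (cramer₂ p₁′ p₂′ q₁′ q₂′ r₁′ r₂′ pq′ pr′)
        (-‿cong (*-congˡ q₁≈) (*-congˡ r₁≈))
    where
      open ≈-ℝ
      cancel : ∀ {x x′ u u′} → det q r * x ≈ u → det q′ r′ * x′ ≈ u′ → u ≈ u′ → x ≈ x′
      cancel {x} {x′} {u} {u′} dx≈u dx′≈u′ u≈u′ = *-cancelˡ d≉0 (begin
        det q r * x     ≈⟨ dx≈u ⟩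
        u               ≈⟨ u≈u′ ⟩
        u′              ≈⟨ dx′≈u′ ⟨
        det q′ r′ * x′  ≈⟨ *-cong (det-cong q≈ r≈) ≈-refl ⟨
        det q r * x′    ∎)

  -- A zero determinant annihilates the left-hand sides in Cramer's rule, so the differences on the
  -- right vanish.
  dependent⇒αr≈βq : ∀ p₁ p₂ q₁ q₂ r₁ r₂ → let p = p₁ , p₂; q = q₁ , q₂; r = r₁ , r₂ in
    det q r ≈ 0ℝ → p · q ≈ α → p · r ≈ β → α * r₁ ≈ β * q₁ × α * r₂ ≈ β * q₂
  dependent⇒αr≈βq p₁ p₂ q₁ q₂ r₁ r₂ d≈0 pq pr =
    ≈-sym (x-y≈0⇒x≈y (≈-trans (≈-sym (cramer₂ p₁ p₂ q₁ q₂ r₁ r₂ pq pr)) (x≈0⇒x*y≈0 d≈0))) ,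
    x-y≈0⇒x≈y (≈-trans (≈-sym (cramer₁ p₁ p₂ q₁ q₂ r₁ r₂ pq pr)) (x≈0⇒x*y≈0 d≈0))

  dependent⇒r-unique : ∀ {p q r p′ q′ r′} → ¬ (α ≈ 0ℝ) →
    det q r ≈ 0ℝ → det q′ r′ ≈ 0ℝ →
    p · q ≈ α → p · r ≈ β → p′ · q′ ≈ α → p′ · r′ ≈ β →
    q ≈² q′ → r ≈² r′
  dependent⇒r-unique {p₁ , p₂} {q₁ , q₂} {r₁ , r₂} {p₁′ , p₂′} {q₁′ , q₂′} {r₁′ , r₂′}
    α≉0 d≈0 d′≈0 pq pr pq′ pr′ (q₁≈ , q₂≈) =
      let αr₁ , αr₂   = dependent⇒αr≈βq p₁ p₂ q₁ q₂ r₁ r₂ d≈0 pq pr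
          αr₁′ , αr₂′ = dependent⇒αr≈βq p₁′ p₂′ q₁′ q₂′ r₁′ r₂′ d′≈0 pq′ pr′
      in cancel αr₁ αr₁′ q₁≈ , cancel αr₂ αr₂′ q₂≈
    where
      cancel : ∀ {x x′ u u′} → α * x ≈ β * u → α * x′ ≈ β * u′ → u ≈ u′ → x ≈ x′
      cancel αx≈βu αx′≈βu′ u≈u′ =
        *-cancelˡ α≉0 (≈-trans αx≈βu (≈-trans (*-congˡ u≈u′) (≈-sym αx′≈βu′)))

-- Counting triples by an injective code

AllPairs-lookup : ∀ {A : Set} {R : Rel A 0ℓ} {xs : List A} → AllPairs R xs →
  ∀ {i j} → i Fin.< j → R (lookup xs i) (lookup xs j)
AllPairs-lookup (Rx ∷ _)  {zero}  {suc j} _         = All.lookup Rx (∈-lookup j)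
AllPairs-lookup (_ ∷ Rxs) {suc i} {suc j} (s≤s i<j) = AllPairs-lookup Rxs i<j

_≈³_ : Rel Triple 0ℓ
_≈³_ = Setoid._≈_ Triple-setoid

Dependent : Triple → Set
Dependent (_ , q , r) = det q r ≈ 0ℝ

module _ {α β : ℝ} {P : List ℝ²} where

  private n = length P

  -- The leading digit separates the two kinds of triple and accounts for the factor 2; the rest
  -- locates in `P` two points that determine the triple. The decision is an argument because
  -- equality of reals cannot be decided.
  code : ∀ {t} → Π α β P t → Dec (Dependent t) → Fin (2 ℕ.* (n ℕ.* n))
  code ((p∈ , q∈ , r∈) , _) (yes _) = combine {2} zero (combine (index p∈) (index q∈))
  code ((p∈ , q∈ , r∈) , _) (no _)  = combine {2} (suc zero) (combine (index q∈) (index r∈))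

  index-injective : ∀ {x y} (x∈ : x ∈ₚ P) (y∈ : y ∈ₚ P) → index x∈ ≡ index y∈ → x ≈² y
  index-injective = Membership.index-injective ℝ²-setoid

  code-injective : ¬ (α ≈ 0ℝ) → ∀ {t t′} (t∈ : Π α β P t) (t′∈ : Π α β P t′)
    (d : Dec (Dependent t)) (d′ : Dec (Dependent t′)) → code t∈ d ≡ code t′∈ d′ → t ≈³ t′
  code-injective α≉0 {p , q , r} {p′ , q′ , r′}
    ((p∈ , q∈ , r∈) , pq , pr) ((p′∈ , q′∈ , r′∈) , pq′ , pr′) = go
    where
      t∈ : Π α β P (p , q , r)
      t∈ = (p∈ , q∈ , r∈) , pq , pr
      t′∈ : Π α β P (p′ , q′ , r′)
      t′∈ = (p′∈ , q′∈ , r′∈) , pq′ , pr′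
      go : (d : Dec (Dependent (p , q , r))) (d′ : Dec (Dependent (p′ , q′ , r′))) →
        code t∈ d ≡ code t′∈ d′ → (p , q , r) ≈³ (p′ , q′ , r′)
      -- Equal codes identify `p` and `q`; dependence then fixes `r` through `q`.
      go (yes d) (yes d′) eq
        with Fin.combine-injective (index p∈) (index q∈) (index p′∈) (index q′∈)
               (Fin.combine-injectiveʳ {2} zero _ zero _ eq)
      ... | i≡ , j≡ =
        let q≈ = index-injective q∈ q′∈ j≡ in
        index-injective p∈ p′∈ i≡ , q≈ ,
        dependent⇒r-unique {_} {_} {p} {q} {r} {p′} {q′} {r′} α≉0 d d′ pq pr pq′ pr′ q≈
      -- Here the code identifies `q` and `r`, and `p` is recovered from them.
      go (no ¬d) (no _) eq
        with Fin.combine-injective (index q∈) (index r∈) (index q′∈) (index r′∈)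
               (Fin.combine-injectiveʳ {2} (suc zero) _ (suc zero) _ eq)
      ... | i≡ , j≡ =
        let q≈ = index-injective q∈ q′∈ i≡
            r≈ = index-injective r∈ r′∈ j≡
        in independent⇒p-unique {_} {_} {p} {q} {r} {p′} {q′} {r′} ¬d pq pr pq′ pr′ q≈ r≈ , q≈ , r≈
      -- For mixed kinds the leading digits 0 and 1 would have to coincide.
      go (yes _) (no _) eq with () ← Fin.combine-injectiveˡ {2}
        zero (combine (index p∈) (index q∈)) (suc zero) (combine (index q′∈) (index r′∈)) eq
      go (no _) (yes _) eq with () ← Fin.combine-injectiveˡ {2}
        (suc zero) (combine (index q∈) (index r∈)) zero (combine (index p′∈) (index q′∈)) eq

  length-bound : ¬ (α ≈ 0ℝ) → (ts : List Triple) → Unique.Unique Triple-setoid ts →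
    All (Π α β P) ts → length ts ℕ.≤ 2 ℕ.* (n ℕ.* n)
  -- The order on ℕ is decidable, so it suffices to refute a longer list. With an absurdity as goal,
  -- the doubly negated decisions, one per entry of the finite list, can be combined and used
  -- together.
  length-bound α≉0 ts unique ts⊆Π = ℕ.≮⇒≥ λ large →
    All.sequenceM 0ℓ ¬¬-Monad (All.universal {P = ¬_ ∘ ¬_ ∘ Dec ∘ Dependent}
      (λ _ → ¬¬-excluded-middle) ts) λ dec? →
      let t∈ = λ i → All.lookup ts⊆Π (∈-lookup i)
          d  = λ i → All.lookup dec? (∈-lookup i)
          -- A longer list has more positions than codes, so two positions share a code, against
          -- distinctness.
          i , j , i<j , eq = Fin.pigeonhole large λ i → code (t∈ i) (d i)
      in AllPairs-lookup unique i<j (code-injective α≉0 (t∈ i) (t∈ j) (d i) (d j) eq)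

-- Transfer of the bound from naturals to reals

/1-homo-* : ∀ a b → + (a ℕ.* b) ℚ./ 1 ≡ (+ a ℚ./ 1) ℚ.* (+ b ℚ./ 1)
-- `ℚ./` reduces by a gcd and is stuck on variables; unnormalised fractions with denominator 1
-- multiply by computation.
/1-homo-* a b = ℚ.toℚᵘ-injective (begin
  ℚ.toℚᵘ (+ (a ℕ.* b) ℚ./ 1)                          ≈⟨ ℚ.toℚᵘ-fromℚᵘ (mkℚᵘ (+ (a ℕ.* b)) 0) ⟩
  mkℚᵘ (+ (a ℕ.* b)) 0                                ≡⟨ cong (λ z → mkℚᵘ z 0) (ℤ.pos-* a b) ⟩
  mkℚᵘ (+ a) 0 ℚᵘ.* mkℚᵘ (+ b) 0                      ≈⟨ ℚᵘ.*-cong (ℚ.toℚᵘ-fromℚᵘ (mkℚᵘ (+ a) 0))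
                                                                  (ℚ.toℚᵘ-fromℚᵘ (mkℚᵘ (+ b) 0)) ⟨
  ℚ.toℚᵘ (+ a ℚ./ 1) ℚᵘ.* ℚ.toℚᵘ (+ b ℚ./ 1)          ≈⟨ ℚ.toℚᵘ-homo-* (+ a ℚ./ 1) (+ b ℚ./ 1) ⟨
  ℚ.toℚᵘ ((+ a ℚ./ 1) ℚ.* (+ b ℚ./ 1))                ∎)
  where open SetoidReasoning ℚᵘ.≃-setoid

/1-mono-≤ : ∀ {a b} → a ℕ.≤ b → + a ℚ./ 1 ℚ.≤ + b ℚ./ 1
/1-mono-≤ {a} {b} a≤b = ℚ.toℚᵘ-cancel-≤
  (ℚᵘ.≤-respˡ-≃ (ℚᵘ.≃-sym (ℚ.toℚᵘ-fromℚᵘ (mkℚᵘ (+ a) 0)))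
    (ℚᵘ.≤-respʳ-≃ (ℚᵘ.≃-sym (ℚ.toℚᵘ-fromℚᵘ (mkℚᵘ (+ b) 0)))
      (ℚᵘ.*≤* (ℤ.*-monoʳ-≤-nonNeg (+ 1) (ℤ.+≤+ a≤b)))))

-- A witness of `y < x` puts a gap ε between the sequences at index `N`, where the hypothesis orders
-- them the other way.
seq-≤⇒≤ : ∀ {x y} → (∀ n → seq x n ℚ.≤ seq y n) → x ≤ y
seq-≤⇒≤ {x} {y} h (ε , 0<ε , N , k) = ℚ.<-irrefl refl (begin-strict
  seq y N           ≡⟨ ℚ.+-identityʳ (seq y N) ⟨
  seq y N ℚ.+ 0ℚ    <⟨ ℚ.+-monoʳ-< (seq y N) 0<ε ⟩
  seq y N ℚ.+ ε     ≤⟨ k N ℕ.≤-refl ⟩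
  seq x N           ≤⟨ h N ⟩
  seq y N           ∎)
  where open ≤-ℚ

fromℕ-≤-* : ∀ {a} b c → a ℕ.≤ b ℕ.* c → fromℕ a ≤ fromℕ b * fromℕ c
fromℕ-≤-* {a} b c a≤bc = seq-≤⇒≤ {fromℕ a} {fromℕ b * fromℕ c} λ _ →
  subst (+ a ℚ./ 1 ℚ.≤_) (/1-homo-* b c) (/1-mono-≤ a≤bc)

fromℕ-pos : ∀ n → 0ℝ < fromℕ (ℕ.suc n)
fromℕ-pos n = 1ℚ , ℚ.positive⁻¹ 1ℚ , 0 , λ _ _ → /1-mono-≤ (s≤s {0} {n} ℕ.z≤n)

theorem1 : (α β : ℝ) → ¬ (α ≈ 0ℝ) → ¬ (β ≈ 0ℝ) →
    ∃ λ (C : ℝ) → ∃ λ (N : ℝ) → 0ℝ < C × 0ℝ < N ×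
    ((n : ℕ) → N < fromℕ n → (P : List ℝ²) → IsSetOfSize n P →
    ∣ Π α β P ∣≤ (C * fromℕ (n ^ 2)))
-- The constant 2 allows one square for each kind of triple.
theorem1 α β α≉0 _ = fromℕ 2 , fromℕ 1 , fromℕ-pos 1 , fromℕ-pos 0 , bound
  where
    bound : (n : ℕ) → fromℕ 1 < fromℕ n → (P : List ℝ²) → IsSetOfSize n P →
      ∣ Π α β P ∣≤ (fromℕ 2 * fromℕ (n ^ 2))
    bound n _ P record { size = refl } ts unique ts⊆Π = fromℕ-≤-* 2 (n ^ 2)
      -- `n ^ 2` unfolds to `n ℕ.* (n ℕ.* 1)`, hence the rewriting of the inner factor.
      (subst (λ m → length ts ℕ.≤ 2 ℕ.* (n ℕ.* m)) (sym (ℕ.*-identityʳ n))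
        (length-bound {α} {β} {P} α≉0 ts unique ts⊆Π))
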